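{- Let $k\ge2$ and $\ell\ge1$. The length of the longest strictly decreasing subsequence of the permutation $Z_k(\ell)$ is $(k+1)k^{\ell/2-1}-1$ if $\ell$ is even, and $2k^{(\ell-1)/2}-1$ if $\ell$ is odd.
   Context: $Z_k(\ell)$ is the permutation of $\{1,\dots,k^\ell\}$ whose $p$-th entry (for $p=1,\dots,k^\ell$) is $1+\mathrm{rev}_{k,\ell}(p-1)$, where $\mathrm{rev}_{k,\ell}(x)$ is the integer whose $\ell$-digit (zero-padded) base-$k$ representation is the reversal of that of $x$. Equivalently, $Z_k(\ell)$ is the stable configuration (read left to right on layer $\ell+1$) of labeled chip-firing on the infinite rooted directed $k$-ary tree starting from chips $1,\dots,k^\ell$ at the root, under the strategy where each vertex holding chips $c_1<\cdots<c_{kq}$ fires the consecutive $k$-tuples $(c_1,\dots,c_k),(c_{k+1},\dots,c_{2k}),\dots$; in a firing the $i$-th smallest chip of the fired $k$-tuple goes to the $i$-th leftmost child. -}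

module Defs where

open import Data.Fin.Base
  using (Fin; zero; suc; toℕ; opposite; combine; finToFun; funToFin)
open import Data.Fin.Permutation using (Permutation′; permutation; _⟨$⟩ʳ_)
open import Data.Fin.Properties
  using (opposite-involutive; finToFun-funToFin; funToFin-finToFin)
open import Data.List.Base using (List; length; map; allFin)
open import Data.List.Relation.Binary.Sublist.Propositional using (_⊆_)
open import Data.List.Relation.Unary.Linked using (Linked)
open import Data.Nat.Base using (ℕ; zero; suc; _^_; _≤_; _>_)
open import Data.Product.Base using (∃-syntax; _×_)
open import Function.Base using (_∘_)
open import Relation.Binary.PropositionalEquality
  using (_≡_; _≗_; refl; trans; cong; cong₂)

-- finToFun x is the zero-padded ℓ-digit base-k expansion of x, with the most
-- significant digit at index 0; funToFin is its inverse.
rev : ∀ k ℓ → Fin (k ^ ℓ) → Fin (k ^ ℓ)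
rev k ℓ x = funToFin (finToFun {k} {ℓ} x ∘ opposite)

funToFin-cong : ∀ {m n} {f g : Fin m → Fin n} → f ≗ g → funToFin f ≡ funToFin g
funToFin-cong {zero}  f≗g = refl
funToFin-cong {suc m} f≗g =
  cong₂ combine (f≗g zero) (funToFin-cong (f≗g ∘ suc))

rev-involutive : ∀ k ℓ x → rev k ℓ (rev k ℓ x) ≡ x
rev-involutive k ℓ x = trans
  (funToFin-cong λ i → trans
    (finToFun-funToFin (finToFun {k} {ℓ} x ∘ opposite) (opposite i))
    (cong (finToFun {k} {ℓ} x) (opposite-involutive i)))
  (funToFin-finToFin {ℓ} {k} x)

-- Positions and entries are indexed from 0 here: i : Fin (k ^ ℓ) stands for
-- toℕ i + 1 ∈ {1, …, k ^ ℓ}.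
Z : ∀ k ℓ → Permutation′ (k ^ ℓ)
Z k ℓ = permutation (rev k ℓ) (rev k ℓ) (rev-involutive k ℓ) (rev-involutive k ℓ)

-- The entries of σ from left to right, as elements of {1, …, n}.
oneLine : ∀ {n} → Permutation′ n → List ℕ
oneLine {n} σ = map (λ i → suc (toℕ (σ ⟨$⟩ʳ i))) (allFin n)

-- ys ⊆ xs is the order-preserving sublist relation, so ys is a subsequence.
IsDecreasingSubsequence : List ℕ → List ℕ → Set
IsDecreasingSubsequence xs ys = ys ⊆ xs × Linked _>_ ys

IsLongestDecreasingLength : ∀ {n} → Permutation′ n → ℕ → Set
IsLongestDecreasingLength σ m =
  (∃[ ys ] IsDecreasingSubsequence (oneLine σ) ys × length ys ≡ m) ×
  (∀ ys → IsDecreasingSubsequence (oneLine σ) ys → length ys ≤ m)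

{-# OPTIONS --safe #-}
-- Cut each ℓ-digit word as X d s with |X| = p, |s| = q and p + 1 + q = ℓ, and
-- let s̄ be the reversal of s.  Along a decreasing subsequence X weakly increases
-- and s̄ weakly decreases; they cannot both stay fixed, since then d would have
-- to increase (by position) and to decrease (by value).  So X − s̄ strictly
-- increases, and the length is at most k ^ p + k ^ q − 1.  The best bound comes
-- from p = q for odd ℓ and p = q + 1 for even ℓ.
--
-- Conversely, let ℓ = 2r + 1 or ℓ = 2r + 2, read r-digit words as numbers below
-- N = k ^ r, and visit, for x = 0, …, N − 1, the words x μ y with ȳ = N − 1 − x
-- and μ running through a decreasing subsequence of the middle words, inserting
-- between consecutive x < x′ the word x′ ε y for a suitable ε:
-- μ = 1 and ε = 0 for odd ℓ; μ = i (k − 1 − i) and ε = 0 0 for even ℓ.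
module Submission where

open import Defs
open import Data.Fin.Base as Fin
  using (Fin; zero; suc; toℕ; fromℕ; inject₁; opposite; combine; finToFun; funToFin)
open import Data.Fin.Properties as Fin
  using (toℕ<n; toℕ-combine; opposite-prop;
         finToFun-funToFin; funToFin-finToFin)
open import Data.List.Base
  using (List; []; _∷_; [_]; _++_; length; lookup; map; reverse; tabulate; allFin)
open import Data.List.Membership.Propositional using (_∈_)
open import Data.List.Membership.Propositional.Properties using (∈-allFin)
open import Data.List.Properties
  using (++-assoc; length-++; length-map; length-reverse; length-tabulate; reverse-++;
         reverse-injective; reverse-involutive; tabulate-cong; tabulate-lookup;
         unfold-reverse)
open import Data.List.Relation.Binary.Sublist.Propositional
  using (_⊆_; []; _∷_; _∷ʳ_; minimum)
open import Data.List.Relation.Binary.Sublist.Propositional.Properties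
  using (All-resp-⊆) renaming (map⁺ to ⊆-map⁺)
open import Data.List.Relation.Unary.All as All using (All; []; _∷_)
open import Data.List.Relation.Unary.AllPairs using (AllPairs; []; _∷_)
import Data.List.Relation.Unary.AllPairs.Properties as AllPairs
open import Data.List.Relation.Unary.Any using (here; there)
open import Data.List.Relation.Unary.Linked as Linked using (Linked; []; [-]; _∷_)
import Data.List.Relation.Unary.Linked.Properties as Linked
open import Data.Nat
  using (ℕ; zero; suc; _+_; _*_; _∸_; _^_; _/_; _%_; _≤_; _<_; z≤n; s≤s; z<s; NonZero)
open import Data.Nat.Divisibility using (_∣_; divides; m%n≡0⇒n∣m)
open import Data.Nat.DivMod using (m≡m%n+[m/n]*n; m%n<n; m*n/n≡m)
open import Data.Nat.Properties
open import Data.Product using (_×_; _,_; proj₁; proj₂; ∃-syntax)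
open import Data.Fin.Permutation using (Permutation′; _⟨$⟩ʳ_)
open import Data.Sum using (inj₁; inj₂)
open import Function.Base using (_∘_; _on_; id)
open import Level using (0ℓ)
open import Relation.Binary.Core using (Rel)
open import Relation.Binary.Definitions using (Irreflexive; Transitive; tri<; tri≈; tri>)
open import Relation.Binary.PropositionalEquality
  using (_≡_; refl; sym; trans; cong; cong₂; subst; subst₂; module ≡-Reasoning)
open import Relation.Nullary using (¬_; contradiction)

private
  variable
    A B : Set

-- Sublists and strictly sorted lists.

AllPairs-resp-⊆ : {R : Rel A 0ℓ} {xs ys : List A} → xs ⊆ ys → AllPairs R ys → AllPairs R xs
AllPairs-resp-⊆ []            []         = []
AllPairs-resp-⊆ (_ ∷ʳ sub)    (_ ∷ pys)  = AllPairs-resp-⊆ sub pys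
AllPairs-resp-⊆ (refl ∷ sub)  (py ∷ pys) = All-resp-⊆ sub py ∷ AllPairs-resp-⊆ sub pys

⊆-map⁻ : (f : A → B) {ys : List B} (xs : List A) → ys ⊆ map f xs →
         ∃[ zs ] zs ⊆ xs × ys ≡ map f zs
⊆-map⁻ f []       []           = [] , [] , refl
⊆-map⁻ f (x ∷ xs) (_ ∷ʳ sub)   =
  let zs , zs⊆ , eq = ⊆-map⁻ f xs sub in zs , x ∷ʳ zs⊆ , eq
⊆-map⁻ f (x ∷ xs) (refl ∷ sub) =
  let zs , zs⊆ , eq = ⊆-map⁻ f xs sub in x ∷ zs , refl ∷ zs⊆ , cong (f x ∷_) eq

module _ {R : Rel A 0ℓ} (irrefl : Irreflexive _≡_ R) (trans′ : Transitive R) where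

  private
    uncons : ∀ {y ys} {xs : List A} → All (R y) xs → All (_∈ y ∷ ys) xs → All (_∈ ys) xs
    uncons []         []               = []
    uncons (Ryx ∷ py) (here refl ∷ ps) = contradiction Ryx (irrefl refl)
    uncons (_ ∷ py)   (there p ∷ ps)   = p ∷ uncons py ps

  -- If both heads agree, irreflexivity keeps that head out of the tail of `xs`. If the head of `xs`
  -- lies deeper in `ys`, transitivity puts the head of `ys` before all of `xs`, so it can be
  -- skipped. `uncons` does the removal in both cases.
  sorted-∈⇒⊆ : ∀ {xs ys} → AllPairs R xs → AllPairs R ys → All (_∈ ys) xs → xs ⊆ ys
  sorted-∈⇒⊆ []         _          _                = minimum _
  sorted-∈⇒⊆ (px ∷ pxs) (py ∷ pys) (here refl ∷ ps) =
    refl ∷ sorted-∈⇒⊆ pxs pys (uncons px ps)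
  sorted-∈⇒⊆ (px ∷ pxs) (py ∷ pys) (there p ∷ ps)   =
    _ ∷ʳ sorted-∈⇒⊆ (px ∷ pxs) pys
      (p ∷ uncons (All.map (trans′ (All.lookup py p)) px) ps)

Linked-<⇒length≤ : (f : A → ℕ) {b : ℕ} → (∀ x → f x < b) →
                   ∀ {xs} → Linked (_<_ on f) xs → length xs ≤ b
Linked-<⇒length≤ f {b} f<b []             = z≤n
Linked-<⇒length≤ f {b} f<b {x ∷ xs} links = ≤-trans (m≤m+n _ (f x)) (bound links)
  where
  -- The induction carries the value at the head: each link trades one element of the list for a
  -- growth of `f` by at least one.
  bound : ∀ {x xs} → Linked (_<_ on f) (x ∷ xs) → length (x ∷ xs) + f x ≤ b
  bound {x} [-] = f<b x
  bound {x} {y ∷ ys} (fx<fy ∷ links) = begin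
    suc (length (y ∷ ys)) + f x ≡⟨ +-suc (length (y ∷ ys)) (f x) ⟨
    length (y ∷ ys) + suc (f x) ≤⟨ +-monoʳ-≤ (length (y ∷ ys)) fx<fy ⟩
    length (y ∷ ys) + f y       ≤⟨ bound links ⟩
    b                           ∎
    where open ≤-Reasoning

-- Paths indexed by endpoints and number of edges.

data Path {A : Set} (R : Rel A 0ℓ) (x : A) : A → ℕ → Set where
  nil  : Path R x x 0
  _◅_  : ∀ {y z n} → R x y → Path R y z n → Path R x z (suc n)

infixr 5 _◅_

module _ {R : Rel A 0ℓ} where

  _◅◅_ : ∀ {x y z m n} → Path R x y m → Path R y z n → Path R x z (m + n)
  nil     ◅◅ q = q
  (r ◅ p) ◅◅ q = r ◅ (p ◅◅ q)

  vertices : ∀ {x y n} → Path R x y n → List A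
  vertices {x} nil     = [ x ]
  vertices {x} (_ ◅ p) = x ∷ vertices p

  length-vertices : ∀ {x y n} (p : Path R x y n) → length (vertices p) ≡ suc n
  length-vertices nil     = refl
  length-vertices (_ ◅ p) = cong suc (length-vertices p)

  vertices-linked : ∀ {x y n} (p : Path R x y n) → Linked R (vertices p)
  vertices-linked nil             = [-]
  vertices-linked (r ◅ nil)       = r ∷ [-]
  vertices-linked (r ◅ p@(_ ◅ _)) = r ∷ vertices-linked p

module _ {R : Rel A 0ℓ} {S : Rel B 0ℓ} (f : A → B) where

  -- Expanding every edge into `c` edges multiplies the length. This turns the path through all
  -- outer words `x` into the zigzag, one `turn` per edge.
  refine : ∀ {c} → (∀ {x y} → R x y → Path S (f x) (f y) c) →
           ∀ {x y n} → Path R x y n → Path S (f x) (f y) (n * c)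
  refine step nil     = nil
  refine step (r ◅ p) = step r ◅◅ refine step p

  map-path : (∀ {x y} → R x y → S (f x) (f y)) →
             ∀ {x y n} → Path R x y n → Path S (f x) (f y) n
  map-path step nil     = nil
  map-path step (r ◅ p) = step r ◅ map-path step p

fin-path : ∀ n → Path Fin._<_ (zero {n}) (fromℕ n) n
fin-path zero    = nil
fin-path (suc n) = z<s ◅ map-path suc s≤s (fin-path n)

-- Decreasing subsequences as paths of inversions.

Inversion : ∀ {n} → Permutation′ n → Rel (Fin n) 0ℓ
Inversion σ i j = i Fin.< j × (σ ⟨$⟩ʳ j) Fin.< (σ ⟨$⟩ʳ i)

-- A decreasing subsequence pulls back to an increasing list of positions. Consecutive positions
-- form an inversion, so `f` strictly increases along the list while staying below `b`.
decreasing-length-≤ : ∀ {n} (σ : Permutation′ n) (f : Fin n → ℕ) {b : ℕ} →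
  (∀ i → f i < b) → (∀ {i j} → Inversion σ i j → f i < f j) →
  ∀ ys → IsDecreasingSubsequence (oneLine σ) ys → length ys ≤ b
decreasing-length-≤ {n} σ f f<b mono ys (sub , dec) with ⊆-map⁻ _ (allFin n) sub
... | is , is⊆ , refl = subst (_≤ _) (sym (length-map _ is))
  (Linked-<⇒length≤ f f<b
    (Linked.zipWith (λ (i<j , d) → mono (i<j , ≤-pred d))
      ( Linked.AllPairs⇒Linked (AllPairs-resp-⊆ is⊆ (AllPairs.tabulate⁺-< id))
      , Linked.map⁻ dec)))

-- The positions along the path increase and all occur in the sorted list `allFin n`, so
-- `sorted-∈⇒⊆` makes them a sublist of it.
path⇒decreasing : ∀ {n} (σ : Permutation′ n) {x y c} → Path (Inversion σ) x y c →
  ∃[ ys ] IsDecreasingSubsequence (oneLine σ) ys × length ys ≡ suc c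
path⇒decreasing σ p =
  map _ (vertices p) ,
  ( ⊆-map⁺ _ (sorted-∈⇒⊆ Fin.<-irrefl Fin.<-trans
      (Linked.Linked⇒AllPairs Fin.<-trans (Linked.map proj₁ (vertices-linked p)))
      (AllPairs.tabulate⁺-< id)
      (All.universal ∈-allFin (vertices p)))
  , Linked.map⁺ (Linked.map (s≤s ∘ proj₂) (vertices-linked p))) ,
  trans (length-map _ (vertices p)) (length-vertices p)

-- Reversal of indices and of lists.

opposite-fromℕ : ∀ n → opposite (fromℕ n) ≡ zero
opposite-fromℕ zero    = refl
opposite-fromℕ (suc n) = cong inject₁ (opposite-fromℕ n)

opposite-inject₁ : ∀ {n} (i : Fin n) → opposite (inject₁ i) ≡ suc (opposite i)
opposite-inject₁ zero    = refl
opposite-inject₁ (suc i) = cong inject₁ (opposite-inject₁ i)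

opposite-mono-< : ∀ {n} {i j : Fin n} → i Fin.< j → opposite j Fin.< opposite i
opposite-mono-< {n} {i} {j} i<j =
  subst₂ _<_ (sym (opposite-prop j)) (sym (opposite-prop i))
    (∸-monoʳ-< (s≤s i<j) (toℕ<n j))

tabulate-inject₁ : ∀ {n} (f : Fin (suc n) → A) →
                   tabulate f ≡ tabulate (f ∘ inject₁) ++ [ f (fromℕ n) ]
tabulate-inject₁ {n = zero}  f = refl
tabulate-inject₁ {n = suc n} f = cong (f zero ∷_) (tabulate-inject₁ (f ∘ suc))

-- `rev` reverses digits by composing with `opposite`; this turns that into list reversal, so that
-- digit strings can be handled as lists.
tabulate-opposite : ∀ {n} (f : Fin n → A) → tabulate (f ∘ opposite) ≡ reverse (tabulate f)
tabulate-opposite {n = zero}  f = refl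
tabulate-opposite {n = suc n} f = begin
  tabulate (f ∘ opposite)
    ≡⟨ tabulate-inject₁ (f ∘ opposite) ⟩
  tabulate (f ∘ opposite ∘ inject₁) ++ [ f (opposite (fromℕ n)) ]
    ≡⟨ cong₂ (λ xs x → xs ++ [ x ]) (tabulate-cong (cong f ∘ opposite-inject₁)) (cong f (opposite-fromℕ n)) ⟩
  tabulate (f ∘ suc ∘ opposite) ++ [ f zero ]
    ≡⟨ cong (_++ [ f zero ]) (tabulate-opposite (f ∘ suc)) ⟩
  reverse (tabulate (f ∘ suc)) ++ [ f zero ]
    ≡⟨ unfold-reverse (f zero) (tabulate (f ∘ suc)) ⟨
  reverse (tabulate f) ∎
  where open ≡-Reasoning

reverse-++-∷ : ∀ (xs : List A) x ys → reverse (xs ++ x ∷ ys) ≡ reverse ys ++ x ∷ reverse xs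
reverse-++-∷ xs x ys = begin
  reverse (xs ++ x ∷ ys)              ≡⟨ reverse-++ xs (x ∷ ys) ⟩
  reverse (x ∷ ys) ++ reverse xs      ≡⟨ cong (_++ reverse xs) (unfold-reverse x ys) ⟩
  (reverse ys ++ [ x ]) ++ reverse xs     ≡⟨ ++-assoc (reverse ys) [ x ] (reverse xs) ⟩
  reverse ys ++ x ∷ reverse xs        ∎
  where open ≡-Reasoning

split-at : ∀ p {q} (xs : List A) → length xs ≡ p + suc q →
  ∃[ ys ] ∃[ z ] ∃[ zs ] xs ≡ ys ++ z ∷ zs × length ys ≡ p × length zs ≡ q
split-at zero    (x ∷ xs) eq = [] , x , xs , refl , refl , suc-injective eq
split-at (suc p) (x ∷ xs) eq with split-at p xs (suc-injective eq)
... | ys , z , zs , refl , |ys| , |zs| = x ∷ ys , z , zs , refl , cong suc |ys| , |zs|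

-- Words over `Fin k` and their values.

module _ {k : ℕ} where

  Word : Set
  Word = List (Fin k)

  val : Word → ℕ
  val []       = 0
  val (d ∷ ds) = toℕ d * k ^ length ds + val ds

  val-++ : ∀ u v → val (u ++ v) ≡ val u * k ^ length v + val v
  val-++ []      v = refl
  val-++ (d ∷ u) v = begin
    toℕ d * k ^ length (u ++ v) + val (u ++ v)
      ≡⟨ cong₂ (λ n → toℕ d * k ^ n +_) (length-++ u) (val-++ u v) ⟩
    toℕ d * k ^ (length u + length v) + (val u * k ^ length v + val v)
      ≡⟨ cong (λ n → toℕ d * n + (val u * k ^ length v + val v)) (^-distribˡ-+-* k (length u) (length v)) ⟩
    toℕ d * (k ^ length u * k ^ length v) + (val u * k ^ length v + val v)
      ≡⟨ +-assoc _ (val u * k ^ length v) (val v) ⟨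
    toℕ d * (k ^ length u * k ^ length v) + val u * k ^ length v + val v
      ≡⟨ cong (λ n → n + val u * k ^ length v + val v) (*-assoc (toℕ d) _ _) ⟨
    toℕ d * k ^ length u * k ^ length v + val u * k ^ length v + val v
      ≡⟨ cong (_+ val v) (*-distribʳ-+ (k ^ length v) (toℕ d * k ^ length u) (val u)) ⟨
    val (d ∷ u) * k ^ length v + val v ∎
    where open ≡-Reasoning

  val-< : ∀ u → val u < k ^ length u
  val-< []      = z<s
  val-< (d ∷ u) = begin-strict
    toℕ d * k ^ length u + val u        <⟨ +-monoʳ-< (toℕ d * k ^ length u) (val-< u) ⟩
    toℕ d * k ^ length u + k ^ length u ≡⟨ +-comm _ (k ^ length u) ⟩
    suc (toℕ d) * k ^ length u          ≤⟨ *-monoˡ-≤ (k ^ length u) (toℕ<n d) ⟩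
    k * k ^ length u                    ∎
    where open ≤-Reasoning

  -- By `val-<` a tail is worth less than one unit of its prefix, so it cannot make up for a smaller
  -- prefix.
  prefix-< : ∀ {u v a b} → val u < val v → length a ≡ length b → val (u ++ a) < val (v ++ b)
  prefix-< {u} {v} {a} {b} u<v |a|≡|b| = begin-strict
    val (u ++ a)                          ≡⟨ val-++ u a ⟩
    val u * k ^ length a + val a          <⟨ +-monoʳ-< _ (val-< a) ⟩
    val u * k ^ length a + k ^ length a   ≡⟨ +-comm _ (k ^ length a) ⟩
    suc (val u) * k ^ length a            ≤⟨ *-monoˡ-≤ (k ^ length a) u<v ⟩
    val v * k ^ length a                  ≡⟨ cong (λ n → val v * k ^ n) |a|≡|b| ⟩
    val v * k ^ length b                  ≤⟨ m≤m+n _ (val b) ⟩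
    val v * k ^ length b + val b          ≡⟨ val-++ v b ⟨
    val (v ++ b)                          ∎
    where open ≤-Reasoning

  suffix-< : ∀ u {a b} → val a < val b → length a ≡ length b → val (u ++ a) < val (u ++ b)
  suffix-< u {a} {b} a<b |a|≡|b| = begin-strict
    val (u ++ a)                  ≡⟨ val-++ u a ⟩
    val u * k ^ length a + val a  <⟨ +-monoʳ-< _ a<b ⟩
    val u * k ^ length a + val b  ≡⟨ cong (λ n → val u * k ^ n + val b) |a|≡|b| ⟩
    val u * k ^ length b + val b  ≡⟨ val-++ u b ⟨
    val (u ++ b)                  ∎
    where open ≤-Reasoning

  head-< : ∀ {d e : Fin k} {a b} → d Fin.< e → length a ≡ length b → val (d ∷ a) < val (e ∷ b)
  head-< {d} {e} {a} {b} d<e = prefix-< {[ d ]} {[ e ]} {a} {b}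
    (subst₂ _<_ (sym (val-[_] d)) (sym (val-[_] e)) d<e)
    where
    val-[_] : ∀ c → val [ c ] ≡ toℕ c
    val-[ c ] = trans (+-identityʳ _) (*-identityʳ (toℕ c))

  prefix-≤ : ∀ {u v a b} → length a ≡ length b → val (u ++ a) < val (v ++ b) → val u ≤ val v
  prefix-≤ {u} {v} {a} {b} |a|≡|b| ua<vb =
    ≮⇒≥ λ v<u → <-asym ua<vb (prefix-< {v} {u} {b} {a} v<u (sym |a|≡|b|))

  val-injective : ∀ u v → length u ≡ length v → val u ≡ val v → u ≡ v
  val-injective []      []      _  _   = refl
  val-injective (d ∷ u) (e ∷ v) eq du≡ev with Fin.<-cmp d e
  ... | tri< d<e _ _  = contradiction du≡ev (<⇒≢ (head-< {a = u} {v} d<e (suc-injective eq)))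
  ... | tri> _ _ e<d  = contradiction (sym du≡ev) (<⇒≢ (head-< {a = v} {u} e<d (sym (suc-injective eq))))
  ... | tri≈ _ refl _ = cong (d ∷_) (val-injective u v |u|≡|v|
        (+-cancelˡ-≡ _ _ _ (trans du≡ev (cong (λ n → toℕ d * k ^ n + val v) (sym |u|≡|v|)))))
    where |u|≡|v| = suc-injective eq

  middle-< : ∀ u {d e : Fin k} v → val (u ++ d ∷ v) < val (u ++ e ∷ v) → d Fin.< e
  middle-< u {d} {e} v lt = *-cancelʳ-< _ _ _ (+-cancelʳ-< (val v) _ _
    (+-cancelˡ-< (val u * k ^ suc (length v)) _ _
      (subst₂ _<_ (val-++ u (d ∷ v)) (val-++ u (e ∷ v)) lt)))

  -- Words as positions of `Z`.

  infix 4 _≺_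
  -- Read forwards, a word is a position; read backwards, it is the entry of `Z` at that position.
  -- This is therefore the inversion relation carried over to words.
  _≺_ : Rel Word 0ℓ
  u ≺ v = val u < val v × val (reverse v) < val (reverse u)

  val-tabulate : ∀ {ℓ} (f : Fin ℓ → Fin k) → val (tabulate f) ≡ toℕ (funToFin f)
  val-tabulate {zero}  f = refl
  val-tabulate {suc ℓ} f = begin
    toℕ (f zero) * k ^ length (tabulate (f ∘ suc)) + val (tabulate (f ∘ suc))
      ≡⟨ cong₂ (λ n → toℕ (f zero) * k ^ n +_) (length-tabulate (f ∘ suc)) (val-tabulate (f ∘ suc)) ⟩
    toℕ (f zero) * k ^ ℓ + toℕ (funToFin (f ∘ suc))
      ≡⟨ cong (_+ toℕ (funToFin (f ∘ suc))) (*-comm (toℕ (f zero)) (k ^ ℓ)) ⟩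
    k ^ ℓ * toℕ (f zero) + toℕ (funToFin (f ∘ suc))
      ≡⟨ toℕ-combine (f zero) (funToFin (f ∘ suc)) ⟨
    toℕ (combine (f zero) (funToFin (f ∘ suc))) ∎
    where open ≡-Reasoning

  module _ (ℓ : ℕ) where

    digits : Fin (k ^ ℓ) → Word
    digits i = tabulate (finToFun {k} {ℓ} i)

    length-digits : ∀ i → length (digits i) ≡ ℓ
    length-digits i = length-tabulate (finToFun {k} {ℓ} i)

    val-digits : ∀ i → val (digits i) ≡ toℕ i
    val-digits i = trans (val-tabulate (finToFun {k} {ℓ} i)) (cong toℕ (funToFin-finToFin {ℓ} {k} i))

    val-reverse-digits : ∀ i → val (reverse (digits i)) ≡ toℕ (rev k ℓ i)
    val-reverse-digits i = trans (cong val (sym (tabulate-opposite (finToFun {k} {ℓ} i)))) (val-tabulate (finToFun {k} {ℓ} i ∘ opposite))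

    inversion⇒≺ : ∀ {i j} → Inversion (Z k ℓ) i j → digits i ≺ digits j
    inversion⇒≺ {i} {j} (i<j , rev-j<rev-i) =
      subst₂ _<_ (sym (val-digits i)) (sym (val-digits j)) i<j ,
      subst₂ _<_ (sym (val-reverse-digits j)) (sym (val-reverse-digits i)) rev-j<rev-i

    ≺⇒inversion : ∀ {i j} → digits i ≺ digits j → Inversion (Z k ℓ) i j
    ≺⇒inversion {i} {j} (i<j , rev-j<rev-i) =
      subst₂ _<_ (val-digits i) (val-digits j) i<j ,
      subst₂ _<_ (val-reverse-digits j) (val-reverse-digits i) rev-j<rev-i

  -- The length enters through an equation, so that words whose lengths are only provably equal give
  -- indices into the same `Z k ℓ`.
  encode : ∀ {ℓ} (u : Word) → length u ≡ ℓ → Fin (k ^ ℓ)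
  encode u refl = funToFin (lookup u)

  digits-encode : ∀ {ℓ} (u : Word) (eq : length u ≡ ℓ) → digits ℓ (encode u eq) ≡ u
  digits-encode u refl = trans (tabulate-cong (finToFun-funToFin (lookup u))) (tabulate-lookup u)

  encode-≺ : ∀ {ℓ} u v (|u| : length u ≡ ℓ) (|v| : length v ≡ ℓ) →
             u ≺ v → Inversion (Z k ℓ) (encode u |u|) (encode v |v|)
  encode-≺ {ℓ} u v |u| |v| u≺v = ≺⇒inversion ℓ
    (subst₂ _≺_ (sym (digits-encode u |u|)) (sym (digits-encode v |v|)) u≺v)

  -- The upper bound.

  -- The difference `val u` - `val (reverse w)`, shifted by `k ^ q` - 1 to stay a natural number.
  -- For `w` of length `q` the subtraction does not truncate.
  rank : ℕ → Word → Word → ℕ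
  rank q u w = val u + (k ^ q ∸ suc (val (reverse w)))

  rank-< : ∀ {p q} u w → length u ≡ p → length w ≡ q → rank q u w < k ^ p + k ^ q ∸ 1
  rank-< {p} {q} u w refl refl = begin-strict
    val u + (k ^ q ∸ suc (val (reverse w))) ≤⟨ +-monoʳ-≤ (val u) (∸-monoʳ-≤ (k ^ q) (s≤s z≤n)) ⟩
    val u + (k ^ q ∸ 1)                     <⟨ +-monoˡ-< (k ^ q ∸ 1) (val-< u) ⟩
    -- Positivity of `k ^ q` comes from the word `w` itself, through `val-<`.
    k ^ p + (k ^ q ∸ 1)                     ≡⟨ +-∸-assoc (k ^ p) (≤-<-trans z≤n (val-< w)) ⟨
    k ^ p + k ^ q ∸ 1                       ∎
    where open ≤-Reasoning

  rank-mono : ∀ {q} u d w u′ d′ w′ → length u ≡ length u′ → length w ≡ q → length w′ ≡ q →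
              u ++ d ∷ w ≺ u′ ++ d′ ∷ w′ → rank q u w < rank q u′ w′
  rank-mono {q} u d w u′ d′ w′ |u|≡|u′| |w| |w′| (pos , value)
    -- Reversal brings the tails to the front, so `prefix-≤` applies to positions and to entries
    -- alike.
    with value′ ← subst₂ _<_ (cong val (reverse-++-∷ u′ d′ w′)) (cong val (reverse-++-∷ u d w)) value
    with m≤n⇒m<n∨m≡n (prefix-≤ {u} {u′} (cong suc (trans |w| (sym |w′|))) pos)
       | m≤n⇒m<n∨m≡n (prefix-≤ {reverse w′} {reverse w} |d′u′|≡|du| value′)
    where
    |d′u′|≡|du| : length (d′ ∷ reverse u′) ≡ length (d ∷ reverse u)
    |d′u′|≡|du| = cong suc
      (trans (length-reverse u′) (trans (sym |u|≡|u′|) (sym (length-reverse u))))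
  ... | inj₁ u<u′ | inj₁ w′<w = +-mono-<-≤ u<u′ (∸-monoʳ-≤ (k ^ q) (s≤s (<⇒≤ w′<w)))
  ... | inj₁ u<u′ | inj₂ w′≡w = +-mono-<-≤ u<u′ (∸-monoʳ-≤ (k ^ q) (s≤s (≤-reflexive w′≡w)))
  -- Strictness survives `∸` only because `val (reverse w)` is below `k ^ q`; otherwise both sides
  -- could truncate to 0.
  ... | inj₂ u≡u′ | inj₁ w′<w = +-mono-≤-< (≤-reflexive u≡u′)
          (∸-monoʳ-< (s≤s w′<w) (subst (λ n → val (reverse w) < k ^ n)
            (trans (length-reverse w) |w|) (val-< (reverse w))))
  ... | inj₂ u≡u′ | inj₂ w′≡w
    with refl ← val-injective u u′ |u|≡|u′| u≡u′
    with refl ← reverse-injective {x = w′} {y = w} (val-injective (reverse w′) (reverse w)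
           (trans (length-reverse w′) (trans |w′| (trans (sym |w|) (sym (length-reverse w))))) w′≡w)
    = contradiction (middle-< (reverse w) (reverse u) value′)
        (<-asym (middle-< u w pos))

  Z-upper : ∀ p q {ℓ} → p + suc q ≡ ℓ → ∀ ys →
            IsDecreasingSubsequence (oneLine (Z k ℓ)) ys → length ys ≤ k ^ p + k ^ q ∸ 1
  Z-upper p q refl = decreasing-length-≤ (Z k (p + suc q)) f f< mono
    where
    split : ∀ i → ∃[ u ] ∃[ d ] ∃[ w ] digits (p + suc q) i ≡ u ++ d ∷ w × length u ≡ p × length w ≡ q
    split i = split-at p (digits (p + suc q) i) (length-digits (p + suc q) i)

    f : Fin (k ^ (p + suc q)) → ℕ
    f i = let u , _ , w , _ = split i in rank q u w

    f< : ∀ i → f i < k ^ p + k ^ q ∸ 1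
    f< i = let u , _ , w , _ , |u| , |w| = split i in rank-< u w |u| |w|

    mono : ∀ {i j} → Inversion (Z k (p + suc q)) i j → f i < f j
    mono {i} {j} inv =
      let u , d , w , eq , |u| , |w| = split i
          u′ , d′ , w′ , eq′ , |u′| , |w′| = split j
      in rank-mono u d w u′ d′ w′ (trans |u| (sym |u′|)) |w| |w′|
           (subst₂ _≺_ eq eq′ (inversion⇒≺ (p + suc q) inv))

  -- The zigzag for the lower bound.

  module Zigzag {r h : ℕ} where

    -- The last block holds the digits of `y` reversed, so reversing a word merely swaps `x` with
    -- `y` and reverses `μ`. Entries can then be compared by the same lemmas as positions.
    word : Fin (k ^ r) → Word → Fin (k ^ r) → Word
    word x μ y = digits r x ++ μ ++ reverse (digits r y)

    reverse-word : ∀ x μ y → reverse (word x μ y) ≡ word y (reverse μ) x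
    reverse-word x μ y = begin
      reverse (X ++ μ ++ reverse Y)                ≡⟨ reverse-++ X (μ ++ reverse Y) ⟩
      reverse (μ ++ reverse Y) ++ reverse X        ≡⟨ cong (_++ reverse X) (reverse-++ μ (reverse Y)) ⟩
      (reverse (reverse Y) ++ reverse μ) ++ reverse X
        ≡⟨ cong (λ v → (v ++ reverse μ) ++ reverse X) (reverse-involutive Y) ⟩
      (Y ++ reverse μ) ++ reverse X                ≡⟨ ++-assoc Y (reverse μ) (reverse X) ⟩
      Y ++ reverse μ ++ reverse X                  ∎
      where
      open ≡-Reasoning
      X Y : Word
      X = digits r x
      Y = digits r y

    length-tail : ∀ μ y → length μ ≡ h → length (μ ++ reverse (digits r y)) ≡ h + r
    length-tail μ y refl = trans (length-++ μ)
      (cong (length μ +_) (trans (length-reverse (digits r y)) (length-digits r y)))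

    length-word : ∀ x μ y → length μ ≡ h → length (word x μ y) ≡ r + (h + r)
    length-word x μ y |μ| = trans (length-++ (digits r x))
      (cong₂ _+_ (length-digits r x) (length-tail μ y |μ|))

    word-outer-< : ∀ {x x′} μ μ′ y y′ → length μ ≡ h → length μ′ ≡ h → x Fin.< x′ →
                   val (word x μ y) < val (word x′ μ′ y′)
    word-outer-< {x} {x′} μ μ′ y y′ |μ| |μ′| x<x′ =
      prefix-< {digits r x} {digits r x′}
        (subst₂ _<_ (sym (val-digits r x)) (sym (val-digits r x′)) x<x′)
        (trans (length-tail μ y |μ|) (sym (length-tail μ′ y′ |μ′|)))

    word-middle-< : ∀ x μ μ′ y y′ → length μ ≡ h → length μ′ ≡ h → val μ < val μ′ →
                    val (word x μ y) < val (word x μ′ y′)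
    word-middle-< x μ μ′ y y′ |μ| |μ′| μ<μ′ =
      suffix-< (digits r x)
        (prefix-< {μ} {μ′} μ<μ′
          (trans (length-reverse (digits r y)) (trans (length-digits r y)
            (sym (trans (length-reverse (digits r y′)) (length-digits r y′))))))
        (trans (length-tail μ y |μ|) (sym (length-tail μ′ y′ |μ′|)))

    -- Both inequalities on `ε` concern only an end of the middle chain, since the connecting word
    -- sits between the last word of one block and the first word of the next.
    module _ {s : ℕ} (mid : Fin (suc s) → Word) (ε : Word)
             (|mid| : ∀ i → length (mid i) ≡ h) (|ε| : length ε ≡ h)
             (mid-≺ : ∀ {i j} → i Fin.< j → mid i ≺ mid j)
             (ε<first : val ε < val (mid zero))
             (ε<last : val (reverse ε) < val (reverse (mid (fromℕ s))))
             where

      private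
        |rev| : ∀ (μ : Word) → length μ ≡ h → length (reverse μ) ≡ h
        |rev| μ |μ| = trans (length-reverse μ) |μ|

        P : Fin (k ^ (r + (h + r))) → Fin (k ^ (r + (h + r))) → ℕ → Set
        P = Path (Inversion (Z k (r + (h + r))))

        mk : ∀ x μ y → length μ ≡ h → Fin (k ^ (r + (h + r)))
        mk x μ y |μ| = encode (word x μ y) (length-word x μ y |μ|)

        mk-≺ : ∀ x μ y (|μ| : length μ ≡ h) x′ μ′ y′ (|μ′| : length μ′ ≡ h) →
               val (word x μ y) < val (word x′ μ′ y′) →
               val (word y′ (reverse μ′) x′) < val (word y (reverse μ) x) →
               Inversion (Z k (r + (h + r))) (mk x μ y |μ|) (mk x′ μ′ y′ |μ′|)
        mk-≺ x μ y |μ| x′ μ′ y′ |μ′| pos value =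
          encode-≺ (word x μ y) (word x′ μ′ y′) (length-word x μ y |μ|) (length-word x′ μ′ y′ |μ′|)
            (pos , subst₂ _<_ (sym (cong val (reverse-word x′ μ′ y′)))
                              (sym (cong val (reverse-word x μ y))) value)

        node : Fin (suc s) → Fin (k ^ r) → Fin (k ^ (r + (h + r)))
        node i x = mk x (mid i) (opposite x) (|mid| i)

        block : ∀ x → P (node zero x) (node (fromℕ s) x) s
        block x = map-path (λ i → node i x) step (fin-path s)
          where
          step : ∀ {i j} → i Fin.< j → Inversion (Z k (r + (h + r))) (node i x) (node j x)
          step {i} {j} i<j = mk-≺ x (mid i) y (|mid| i) x (mid j) y (|mid| j)
            (word-middle-< x (mid i) (mid j) y y (|mid| i) (|mid| j) (proj₁ (mid-≺ i<j)))
            (word-middle-< y (reverse (mid j)) (reverse (mid i)) x x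
              (|rev| (mid j) (|mid| j)) (|rev| (mid i) (|mid| i)) (proj₂ (mid-≺ i<j)))
            where y = opposite x

        -- After the `s` edges of the block come two more. On the first, the position rises with `x`
        -- and the entry falls by `ε<last`; on the second, the position rises by `ε<first` and the
        -- entry falls because `opposite` reverses the order.
        turn : ∀ {x x′} → x Fin.< x′ → P (node zero x) (node zero x′) (s + 2)
        turn {x} {x′} x<x′ = block x ◅◅ (
          mk-≺ x last y |last| x′ ε y |ε|
            (word-outer-< last ε y y |last| |ε| x<x′)
            (word-middle-< y (reverse ε) (reverse last) x′ x
              (|rev| ε |ε|) (|rev| last |last|) ε<last) ◅
          mk-≺ x′ ε y |ε| x′ first y′ |first|
            (word-middle-< x′ ε first y y′ |ε| |first| ε<first)
            (word-outer-< (reverse first) (reverse ε) x′ x′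
              (|rev| first |first|) (|rev| ε |ε|) (opposite-mono-< x<x′)) ◅
          nil)
          where
          y y′ : Fin (k ^ r)
          y  = opposite x
          y′ = opposite x′
          first last : Word
          first = mid zero
          last  = mid (fromℕ s)
          |first| = |mid| zero
          |last|  = |mid| (fromℕ s)

      -- With N = `k ^ r` there are N blocks of `s` + 1 words and N - 1 connecting words, (`s` + 2)
      -- N - 1 in total.
      Z-lower : .{{NonZero k}} →
        ∃[ ys ] IsDecreasingSubsequence (oneLine (Z k (r + (h + r)))) ys
              × length ys ≡ (s + 2) * k ^ r ∸ 1
      Z-lower = let ys , dec , eq = path⇒decreasing (Z k (r + (h + r))) (proj₂ (proj₂ long))
                in ys , dec , trans eq count
        where
        n : ℕ
        n = k ^ r ∸ 1

        N≡ : k ^ r ≡ suc n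
        N≡ = sym (m+[n∸m]≡n (m^n>0 k r))

        -- Generalising `k ^ r` to a variable `N` lets the equation be matched with `refl`.
        fin-path′ : ∀ {N} → N ≡ suc n → ∃[ x ] ∃[ y ] Path (Fin._<_ {N} {N}) x y n
        fin-path′ refl = _ , _ , fin-path n

        long : ∃[ x ] ∃[ y ] P x y (n * (s + 2) + s)
        long = let _ , y , p = fin-path′ N≡ in _ , _ , refine (node zero) turn p ◅◅ block y

        count : suc (n * (s + 2) + s) ≡ (s + 2) * k ^ r ∸ 1
        count = begin
          suc (n * (s + 2) + s)             ≡⟨ +-suc (n * (s + 2)) s ⟨
          n * (s + 2) + suc s               ≡⟨ +-comm (n * (s + 2)) (suc s) ⟩
          suc (suc s) + n * (s + 2) ∸ 1     ≡⟨ cong (λ m → m + n * (s + 2) ∸ 1) (+-comm 2 s) ⟩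
          suc n * (s + 2) ∸ 1               ≡⟨ cong (_∸ 1) (*-comm (suc n) (s + 2)) ⟩
          (s + 2) * suc n ∸ 1               ≡⟨ cong (λ N → (s + 2) * N ∸ 1) N≡ ⟨
          (s + 2) * k ^ r ∸ 1               ∎
          where open ≡-Reasoning

-- The two parities.

Z-longest-odd : ∀ k r {ℓ} → 2 ≤ k → suc (r * 2) ≡ ℓ →
                IsLongestDecreasingLength (Z k ℓ) (2 * k ^ r ∸ 1)
Z-longest-odd k@(suc (suc _)) r (s≤s (s≤s _)) refl =
  subst (λ ℓ → ∃[ ys ] IsDecreasingSubsequence (oneLine (Z k ℓ)) ys × length ys ≡ 2 * k ^ r ∸ 1)
    -- Here `s` = 0: the middle chain is the single word 1, so its ordering condition is vacuous,
    -- and one-letter words equal their reversals.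
    len (Zigzag.Z-lower {k} {r} {1} {0} (λ _ → [ suc zero ]) [ zero ]
      (λ _ → refl) refl (λ { {zero} {zero} () }) 0<1 0<1) ,
  λ ys dec → subst (λ m → length ys ≤ k ^ r + m ∸ 1) (sym (+-identityʳ (k ^ r)))
    (Z-upper r r len ys dec)
  where
  0<1 : val {k} [ zero ] < val {k} [ suc zero ]
  0<1 = z<s

  len : r + suc r ≡ suc (r * 2)
  len = trans (+-suc r r) (cong suc (sym (trans (*-comm r 2) (cong (r +_) (+-identityʳ r)))))

Z-longest-even : ∀ k r {ℓ} → 2 ≤ k → suc r * 2 ≡ ℓ →
                 IsLongestDecreasingLength (Z k ℓ) ((k + 1) * k ^ r ∸ 1)
Z-longest-even k@(suc k₁@(suc _)) r (s≤s (s≤s _)) refl =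
  subst₂ (λ ℓ m → ∃[ ys ] IsDecreasingSubsequence (oneLine (Z k ℓ)) ys × length ys ≡ m * k ^ r ∸ 1)
    (trans (+-suc r (suc r)) len) (+-suc k₁ 1)
    -- All `k` words `mid i` are used, so `s` = `k₁` = `k` - 1 and the factor `s` + 2 is `k` + 1.
    (Zigzag.Z-lower {k} {r} {2} {k₁} mid (zero ∷ zero ∷ [])
      (λ _ → refl) refl mid-≺ z<s ε<last) ,
  λ ys dec → subst (λ m → length ys ≤ m ∸ 1) num (Z-upper (suc r) r len ys dec)
  where
  mid : Fin k → Word
  mid i = i ∷ opposite i ∷ []

  mid-≺ : ∀ {i j} → i Fin.< j → mid i ≺ mid j
  mid-≺ {i} {j} i<j = head-< {a = [ opposite i ]} {[ opposite j ]} i<j refl ,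
                      head-< {a = [ j ]} {[ i ]} (opposite-mono-< i<j) refl

  ε<last : val {k} (zero ∷ zero ∷ []) < val {k} (opposite (fromℕ k₁) ∷ fromℕ k₁ ∷ [])
  -- The last middle word reversed is 0 (`k` - 1), which exceeds 0 0 because `k` ≥ 2.
  ε<last rewrite opposite-fromℕ k₁ = z<s

  len : suc r + suc r ≡ suc r * 2
  len = sym (trans (*-comm (suc r) 2) (cong (suc r +_) (+-identityʳ (suc r))))

  num : k * k ^ r + k ^ r ≡ (k + 1) * k ^ r
  num = trans (+-comm _ (k ^ r)) (cong (_* k ^ r) (+-comm 1 k))

theorem7p3 : ∀ (k ℓ : ℕ) → 2 ≤ k → 1 ≤ ℓ →
    (2 ∣ ℓ → IsLongestDecreasingLength (Z k ℓ) ((k + 1) * k ^ (ℓ / 2 ∸ 1) ∸ 1)) ×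
    (¬ (2 ∣ ℓ) → IsLongestDecreasingLength (Z k ℓ) (2 * k ^ ((ℓ ∸ 1) / 2) ∸ 1))
theorem7p3 k ℓ 2≤k 1≤ℓ = even , odd
  where
  even : 2 ∣ ℓ → IsLongestDecreasingLength (Z k ℓ) ((k + 1) * k ^ (ℓ / 2 ∸ 1) ∸ 1)
  even (divides zero    eq) = contradiction (subst (1 ≤_) eq 1≤ℓ) λ ()
  even (divides (suc r) eq) =
    subst (λ m → IsLongestDecreasingLength (Z k ℓ) ((k + 1) * k ^ (m ∸ 1) ∸ 1))
      (sym (trans (cong (_/ 2) eq) (m*n/n≡m (suc r) 2)))
      (Z-longest-even k r 2≤k (sym eq))

  odd : ¬ (2 ∣ ℓ) → IsLongestDecreasingLength (Z k ℓ) (2 * k ^ ((ℓ ∸ 1) / 2) ∸ 1)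
  odd 2∤ℓ =
    subst (λ m → IsLongestDecreasingLength (Z k ℓ) (2 * k ^ m ∸ 1))
      -- For odd `ℓ` the quotient `ℓ / 2` already equals (`ℓ` - 1) / 2.
      (sym (trans (cong (λ n → (n ∸ 1) / 2) eq) (m*n/n≡m (ℓ / 2) 2)))
      (Z-longest-odd k (ℓ / 2) 2≤k (sym eq))
    where
    ℓ%2≡1 : ℓ % 2 ≡ 1
    ℓ%2≡1 = ≤-antisym (≤-pred (m%n<n ℓ 2)) (n≢0⇒n>0 (2∤ℓ ∘ m%n≡0⇒n∣m ℓ 2))

    eq : ℓ ≡ suc (ℓ / 2 * 2)
    eq = trans (m≡m%n+[m/n]*n ℓ 2) (cong (_+ ℓ / 2 * 2) ℓ%2≡1)
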